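{- Let $G$ be a connected, planar graph associated to a link shadow $D$. Suppose that $G$ is the union of two subgraphs, $T_1$ and $T_2$, where $T_1$ and $T_2$ are edge-disjoint spanning trees for $G$. Then $G$ is a $\mathcal{P}$-position game for the Link Smoothing Game.
   Context: A link shadow $D$ is a connected link diagram in which under/over information is unspecified at the crossings (called precrossings). Link Smoothing Game on $D$: two players, $K$ (Knot) and $L$ (Link), alternately select a remaining precrossing and replace it by either of its two smoothings (horizontal or vertical), until no precrossings remain. The goal of $K$ is to keep the diagram connected; the goal of $L$ is to disconnect it (once disconnected, the diagram stays disconnected). Graph of a shadow: checkerboard color the regions of $D$; the (black) graph $G$ has one vertex per black region and one edge per precrossing, joining the black regions meeting there (loops and multiple edges allowed). The white graph is its planar dual $G^*$. Smoothing a precrossing amounts to either deleting the corresponding edge of $G$ (and contracting the dual edge in $G^*$) or contracting it in $G$ (and deleting the dual edge in $G^*$). The shadow is connected if and only if both graphs are connected. Thus the game can be played on $G$: players alternately choose a remaining edge and delete or contract it, and $L$ wins if either $G$ or $G^*$ becomes disconnected. The outcome class of $G$ means that of the corresponding shadow. $\mathcal{P}$-position means that the previous player (that is, the second player to move), whichever of $K$ and $L$ that is, can guarantee a win. -}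

module Defs where

open import Data.Fin using (Fin)
open import Data.Fin.Patterns using (0F; 1F; 2F; 3F)
open import Data.Fin.Subset using (Subset; _∈_; ⊤)
open import Data.List using (List; []; _∷_)
open import Data.List.Relation.Unary.All using (All)
open import Data.List.Relation.Unary.Unique.Propositional using (Unique)
open import Data.Maybe using (Maybe; just; nothing)
open import Data.Nat using (ℕ; _+_; _*_)
open import Data.Product using (_×_; _,_; ∃; ∃-syntax)
open import Data.Sum using (_⊎_)
open import Data.Vec using (Vec; lookup; replicate; _[_]≔_)
open import Function using (_⇔_)
open import Function.Definitions using (StrictlySurjective)
open import Relation.Binary.Construct.Closure.Equivalence using (EqClosure)
open import Relation.Binary.PropositionalEquality using (_≡_; _≢_; refl; trans; cong)
open import Relation.Nullary using (¬_)

------------------------------------------------------------------------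
-- Multigraphs and spanning trees

record Multigraph : Set₁ where
  field
    Vertex    : Set
    size      : ℕ
    endpoints : Fin size → Vertex × Vertex

  Edge : Set
  Edge = Fin size

  Joins : Edge → Vertex → Vertex → Set
  Joins e u v = endpoints e ≡ (u , v) ⊎ endpoints e ≡ (v , u)

  data Walk : Vertex → Vertex → Set where
    stop : ∀ {u} → Walk u u
    step : ∀ {u v w} (e : Edge) → Joins e u v → Walk v w → Walk u w

  edges : ∀ {u v} → Walk u v → List Edge
  edges stop         = []
  edges (step e _ w) = e ∷ edges w

  -- All visited vertices except the final one.
  sources : ∀ {u v} → Walk u v → List Vertex
  sources stop             = []
  sources (step {u} _ _ w) = u ∷ sources w

  -- Distinctness of edges rules out going back and forth along one edge,
  -- while a loop and a pair of parallel edges are cycles.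
  IsCycle : ∀ {u} → Walk u u → Set
  IsCycle w = edges w ≢ [] × Unique (edges w) × Unique (sources w)

  -- An edge set stands for the spanning subgraph with those edges.

  Within : Subset size → ∀ {u v} → Walk u v → Set
  Within p w = All (_∈ p) (edges w)

  ConnectedBy : Subset size → Set
  ConnectedBy p = ∀ u v → ∃[ w ] Within p {u} {v} w

  Acyclic : Subset size → Set
  Acyclic p = ∀ {u} (w : Walk u u) → Within p w → ¬ IsCycle w

  IsSpanningTree : Subset size → Set
  IsSpanningTree p = ConnectedBy p × Acyclic p

  IsConnected : Set
  IsConnected = ConnectedBy ⊤

------------------------------------------------------------------------
-- Smoothings

-- The four ends of arcs at a (pre)crossing, in counterclockwise order.
-- An end (c , i) also names the corner at c between the ends i and ccw i.
End : ℕ → Set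
End n = Fin n × Fin 4

ccw cw : Fin 4 → Fin 4
ccw 0F = 1F
ccw 1F = 2F
ccw 2F = 3F
ccw 3F = 0F
cw 0F = 3F
cw 1F = 0F
cw 2F = 1F
cw 3F = 2F

data Smoothing : Set where
  horizontal vertical : Smoothing

-- A precrossing joins all of its ends; a smoothed one joins them in pairs.
data Joint : Maybe Smoothing → Fin 4 → Fin 4 → Set where
  crossing : ∀ i → Joint nothing i (ccw i)
  h₀₁ : Joint (just horizontal) 0F 1F
  h₂₃ : Joint (just horizontal) 2F 3F
  v₁₂ : Joint (just vertical) 1F 2F
  v₃₀ : Joint (just vertical) 3F 0F

-- A partially smoothed diagram; `nothing` marks a remaining precrossing.
Position : ℕ → Set
Position n = Vec (Maybe Smoothing) n

start : ∀ {n} → Position n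
start {n} = replicate n nothing

module _ {n : ℕ} (arc : End n → End n) where

  data Adjacent (s : Position n) : End n → End n → Set where
    along : ∀ x → Adjacent s x (arc x)
    at    : ∀ c {i j} → Joint (lookup s c) i j → Adjacent s (c , i) (c , j)

  ConnectedDiagram : Position n → Set
  ConnectedDiagram s = ∀ x y → EqClosure (Adjacent s) x y

  -- Leaving the crossing along end i of c, the region at corner (c , i) lies
  -- on the left; on arrival at (c′ , j) the same region is the corner just
  -- clockwise of j.
  nextCorner : End n → End n
  nextCorner x = let (c , j) = arc x in c , cw j

  data SameRegion₁ : End n → End n → Set where
    next : ∀ x → SameRegion₁ x (nextCorner x)

------------------------------------------------------------------------
-- Link shadows

-- A link shadow as a connected 4-valent combinatorial map on the sphere:
-- `arc` matches the two ends of each arc, the regions are the orbits of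
-- `nextCorner`, and planarity is Euler's formula V + F = E + 2.  The fields
-- force at least one crossing: with none there would be no corners, hence no
-- regions, contradicting `euler`.
record Shadow : Set where
  field
    crossings         : ℕ
    arc               : End crossings → End crossings
    arc-involutive    : ∀ x → arc (arc x) ≡ x
    arc-irreflexive   : ∀ x → arc x ≢ x
    connected         : ConnectedDiagram arc start
    regions           : ℕ
    region            : End crossings → Fin regions
    region-surjective : StrictlySurjective _≡_ region
    region-orbit      : ∀ x y → region x ≡ region y ⇔ EqClosure (SameRegion₁ arc) x y
    euler             : crossings + regions ≡ 2 * crossings + 2

data Colour : Set where
  black white : Colour

opposite : Colour → Colour
opposite black = white
opposite white = black

-- The corners (c , i) and (c , ccw i) are the two sides of the arc at the
-- end (c , ccw i).
record Checkerboard (D : Shadow) : Set where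
  open Shadow D
  field
    colour      : Fin regions → Colour
    alternating : ∀ c i → colour (region (c , ccw i)) ≡ opposite (colour (region (c , i)))

module _ (D : Shadow) (χ : Checkerboard D) where
  open Shadow D
  open Checkerboard χ

  BlackRegion : Set
  BlackRegion = ∃[ r ] colour r ≡ black

  BlackCorner : Fin crossings → Set
  BlackCorner c = ∃[ i ] colour (region (c , i)) ≡ black

  blackCorner : ∀ c → BlackCorner c
  blackCorner c with colour (region (c , 0F)) in eq
  ... | black = 0F , eq
  ... | white = 1F , trans (alternating c 0F) (cong opposite eq)

  oppositeCorner : ∀ {c} → BlackCorner c → BlackCorner c
  oppositeCorner {c} (i , eq) =
    ccw (ccw i) ,
    trans (alternating c (ccw i))
          (cong opposite (trans (alternating c i) (cong opposite eq)))

  regionAt : ∀ {c} → BlackCorner c → BlackRegion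
  regionAt {c} (i , eq) = region (c , i) , eq

  blackGraph : Multigraph
  blackGraph = record
    { Vertex    = BlackRegion
    ; size      = crossings
    ; endpoints = λ c → regionAt (blackCorner c) ,
                        regionAt (oppositeCorner (blackCorner c))
    }

------------------------------------------------------------------------
-- The Link Smoothing Game

data Player : Set where
  K L : Player

other : Player → Player
other K = L
other L = K

module _ (D : Shadow) where
  open Shadow D

  Goal : Player → Position crossings → Set
  Goal K s = ConnectedDiagram arc s
  Goal L s = ¬ ConnectedDiagram arc s

  Remaining : Position crossings → Fin crossings → Set
  Remaining s c = lookup s c ≡ nothing

  -- CanWin p q s: player p has a winning strategy from s with q to move.
  data CanWin (p : Player) : Player → Position crossings → Set where
    over   : ∀ {q s} → (∀ c → ¬ Remaining s c) → Goal p s → CanWin p q s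
    move   : ∀ {s} c m → Remaining s c →
             CanWin p (other p) (s [ c ]≔ just m) → CanWin p p s
    answer : ∀ {s} → ∃ (Remaining s) →
             (∀ c m → Remaining s c → CanWin p p (s [ c ]≔ just m)) →
             CanWin p (other p) s

  P-position : Set
  P-position = ∀ first → CanWin (other first) first start

{-# OPTIONS --safe #-}
module Submission where

-- Call an edge set a basis if it is a spanning tree.  As long as K answers
-- every move of L by a symmetric basis exchange (an edge e of one tree against
-- an edge f of the other, one of them contracted and the other deleted), the
-- remaining edges split into two parts, each of which completes the contracted
-- edges to a basis.  When nothing remains, the contracted edges are a spanning
-- tree, and the diagram is the boundary of a neighbourhood of that tree, a
-- single circle.  The exchanges also show that the number of
-- edges is even, so as second player L moves last; of the two smoothings of the
-- last crossing, one closes up the strand leaving it into a circle that misses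
-- another end.

open import Defs
open import Data.Bool as Bool using (Bool; true; false; if_then_else_)
open import Data.Bool.Properties using (¬-not)
open import Data.Empty using (⊥)
open import Data.Fin using (Fin; toℕ; combine; zero; suc)
open import Data.Fin.Patterns using (0F; 1F; 2F; 3F)
import Data.Fin.Properties as Fin
open import Data.Fin.Subset using (Subset; Empty; _∩_; _∪_; ⊤)
open import Data.Fin.Subset.Properties using (x∈p∩q⁺; x∈p∪q⁻; ∈⊤)
open import Data.List using (List; []; _∷_; allFin; filter)
import Data.List.Membership.DecPropositional as DecMembership
open import Data.List.Membership.Propositional using () renaming (_∈_ to _∈ₗ_; _∉_ to _∉ₗ_)
open import Data.List.Membership.Propositional.Properties using (∈-filter⁺; ∈-filter⁻; ∈-allFin)
open import Data.List.Relation.Unary.All as All using (All; []; _∷_)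
open import Data.List.Relation.Unary.AllPairs using ([]; _∷_)
open import Data.List.Relation.Unary.Any using (here; there)
open import Data.List.Relation.Unary.Unique.Propositional using (Unique)
open import Data.List.Relation.Unary.Unique.Propositional.Properties using (filter⁺; allFin⁺)
open import Data.Maybe using (just; nothing; Maybe; fromMaybe)
open import Data.Nat using (ℕ; zero; suc; _+_; _*_)
open import Data.Nat.GeneralisedArithmetic using (iterate)
import Data.Nat.Properties as ℕ
open import Data.Product using (_×_; _,_; ∃-syntax; proj₁; proj₂)
open import Data.Sum as Sum using (_⊎_; inj₁; inj₂; [_,_]′)
open import Data.Vec using (lookup; _[_]≔_; Vec; []; _∷_)
open import Data.Vec.Properties using (lookup∘update; lookup∘update′; []=⇒lookup; lookup⇒[]=; []≔-lookup; []≔-commutes; lookup-replicate)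
open import Function using (_∘_; id; case_of_; Equivalence)
open import Level using (0ℓ)
open import Relation.Binary.Construct.Closure.Equivalence as Eq using (EqClosure)
open import Relation.Binary.Construct.Closure.ReflexiveTransitive as Star using (Star; ε; _◅_; _◅◅_)
open import Relation.Binary.Construct.Closure.Symmetric using (fwd; bwd)
open import Relation.Binary.Definitions using (DecidableEquality)
open import Relation.Binary.PropositionalEquality using (_≡_; _≢_; refl; sym; trans; cong; subst; cong₂; subst₂)
open import Relation.Nullary using (¬_; yes; no; contradiction; Dec)
open import Relation.Unary using (Pred; _⊆_)

-- Spanning trees of a multigraph as bases, and symmetric exchange.

module Trees (G : Multigraph) where
  open Multigraph G

  EdgeSet : Set₁
  EdgeSet = Pred Edge 0ℓ

  private variable
    P Q : EdgeSet
    e f g h : Edge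
    a b u v x y : Vertex

  Conn : EdgeSet → Vertex → Vertex → Set
  Conn P = Star (λ u v → ∃[ e ] P e × Joins e u v)

  infixl 6 _∖_ _[_↦_]

  _∖_ : EdgeSet → Edge → EdgeSet
  (P ∖ e) f = P f × f ≢ e

  _[_↦_] : EdgeSet → Edge → Edge → EdgeSet
  (P [ g ↦ h ]) e = (P ∖ g) e ⊎ e ≡ h

  joined : P e → Joins e u v → Conn P u v
  joined Pe j = (_ , Pe , j) ◅ ε

  conn-sym : Conn P u v → Conn P v u
  conn-sym = Star.reverse λ (e , Pe , j) → e , Pe , Sum.swap j

  conn-mono : P ⊆ Q → Conn P u v → Conn Q u v
  conn-mono P⊆Q = Star.map λ (e , Pe , j) → e , P⊆Q Pe , j

  joins-determined : Joins e u v → Joins e a b → (a ≡ u × b ≡ v) ⊎ (a ≡ v × b ≡ u)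
  joins-determined (inj₁ p) (inj₁ q) with refl ← trans (sym p) q = inj₁ (refl , refl)
  joins-determined (inj₁ p) (inj₂ q) with refl ← trans (sym p) q = inj₂ (refl , refl)
  joins-determined (inj₂ p) (inj₁ q) with refl ← trans (sym p) q = inj₂ (refl , refl)
  joins-determined (inj₂ p) (inj₂ q) with refl ← trans (sym p) q = inj₁ (refl , refl)

  -- Cutting out what lies between the first and the last use of `f` leaves at most one use; the
  -- last two alternatives are its two directions.
  removeEdge : Joins f u v → Conn P a b →
    Conn (P ∖ f) a b ⊎
    (Conn (P ∖ f) a u × Conn (P ∖ f) v b) ⊎
    (Conn (P ∖ f) a v × Conn (P ∖ f) u b)
  removeEdge j ε = inj₁ ε
  removeEdge {f = f} j ((e , Pe , k) ◅ c) with e Fin.≟ f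
  ... | no e≢f = Sum.map (s ◅_) (Sum.map (λ (p , q) → s ◅ p , q) (λ (p , q) → s ◅ p , q)) (removeEdge j c)
    where s = e , (Pe , e≢f) , k
  ... | yes refl with joins-determined j k | removeEdge j c
  ... | inj₁ (refl , refl) | inj₁ p              = inj₂ (inj₁ (ε , p))
  ... | inj₁ (refl , refl) | inj₂ (inj₁ (_ , p)) = inj₂ (inj₁ (ε , p))
  ... | inj₁ (refl , refl) | inj₂ (inj₂ (_ , p)) = inj₁ p
  ... | inj₂ (refl , refl) | inj₁ p              = inj₂ (inj₂ (ε , p))
  ... | inj₂ (refl , refl) | inj₂ (inj₁ (_ , p)) = inj₁ p
  ... | inj₂ (refl , refl) | inj₂ (inj₂ (_ , p)) = inj₂ (inj₂ (ε , p))

  -- Acyclicity is stated through connectivity alone, so that it can be tracked through an exchange.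
  -- A loop is excluded by the empty path.
  record IsBasis (P : EdgeSet) : Set where
    field
      spanning    : ∀ u v → Conn P u v
      independent : ∀ {e u v} → P e → Joins e u v → ¬ Conn (P ∖ e) u v

  open IsBasis

  basis-resp : P ⊆ Q → Q ⊆ P → IsBasis P → IsBasis Q
  basis-resp P⊆Q Q⊆P B = record
    { spanning    = λ u v → conn-mono P⊆Q (spanning B u v)
    ; independent = λ Qe j → independent B (Q⊆P Qe) j ∘ conn-mono (λ (Qf , f≢e) → Q⊆P Qf , f≢e)
    }

  -- Removing `g` leaves a part around `a` and a part around `b`; `u` lies in the first and `v` in
  -- the second, so `h` bridges them again.
  replaceEdge : IsBasis P → P g → Joins g a b → Joins h u v →
    Conn (P ∖ g) a u → Conn (P ∖ g) v b → IsBasis (P [ g ↦ h ])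
  replaceEdge {P} {g} {a} {b} {h} {u} {v} B Pg jg jh au vb = record
    { spanning    = λ x y → Star.concat (Star.map reroute (spanning B x y))
    ; independent = indep
    }
    where
    P′ : EdgeSet
    P′ = P [ g ↦ h ]

    ab : Conn P′ a b
    ab = conn-mono inj₁ au ◅◅ joined (inj₂ refl) jh ◅◅ conn-mono inj₁ vb

    reroute : ∀ {x y} → ∃[ e ] P e × Joins e x y → Conn P′ x y
    reroute (e , Pe , j) with e Fin.≟ g
    ... | no e≢g = joined (inj₁ (Pe , e≢g)) j
    ... | yes refl with joins-determined jg j
    ... | inj₁ (refl , refl) = ab
    ... | inj₂ (refl , refl) = conn-sym ab

    separated : ¬ Conn (P ∖ g) u v
    separated uv = independent B Pg jg (au ◅◅ uv ◅◅ vb)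

    onlyOld : (P′ ∖ h) ⊆ (P ∖ g)
    onlyOld (inj₁ Pe , _)     = Pe
    onlyOld (inj₂ e≡h , e≢h) = contradiction e≡h e≢h

    indep : ∀ {e x y} → P′ e → Joins e x y → ¬ Conn (P′ ∖ e) x y
    indep {e} P′e j xy with e Fin.≟ h
    indep P′e j xy | yes refl with joins-determined jh j
    ... | inj₁ (refl , refl) = separated (conn-mono onlyOld xy)
    ... | inj₂ (refl , refl) = separated (conn-sym (conn-mono onlyOld xy))
    indep {e} P′e j xy | no e≢h with onlyOld (P′e , e≢h)
    -- A path replacing `e` must use `h`, as `P` is independent; its two pieces together with `e`
    -- would then join `u` to `v` without `g`.
    ... | Pe , e≢g = [ (λ c → independent B Pe j (conn-mono weaken c)) , [ through , through′ ]′ ]′ (removeEdge jh xy)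
      where
      weaken : (P′ ∖ e ∖ h) ⊆ (P ∖ e)
      weaken ((P′f , f≢e) , f≢h) = proj₁ (onlyOld (P′f , f≢h)) , f≢e

      old : (P′ ∖ e ∖ h) ⊆ (P ∖ g)
      old ((P′f , _) , f≢h) = onlyOld (P′f , f≢h)

      through : ¬ (Conn (P′ ∖ e ∖ h) _ u × Conn (P′ ∖ e ∖ h) v _)
      through (xu , vy) = separated
        (conn-sym (conn-mono old xu) ◅◅ joined (Pe , e≢g) j ◅◅ conn-sym (conn-mono old vy))

      through′ : ¬ (Conn (P′ ∖ e ∖ h) _ v × Conn (P′ ∖ e ∖ h) u _)
      through′ (xv , uy) = separated
        (conn-mono old uy ◅◅ joined (Pe , e≢g) (Sum.swap j) ◅◅ conn-mono old xv)

  -- Listing the final vertex first makes this the vertex list that a step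
  -- back to the start would close up into a cycle.
  vertices : Walk u v → List Vertex
  vertices {v = v} w = v ∷ sources w

  source∈vertices : (w : Walk u v) → u ∈ₗ vertices w
  source∈vertices stop         = here refl
  source∈vertices (step _ _ _) = there (here refl)

  vertices-step : (w : Walk u v) → x ∈ₗ vertices w → x ∈ₗ v ∷ y ∷ sources w
  vertices-step w (here p)  = here p
  vertices-step w (there p) = there (there p)

  endpoints∈vertices : (w : Walk u v) → e ∈ₗ edges w → Joins e a b → a ∈ₗ vertices w × b ∈ₗ vertices w
  endpoints∈vertices (step e j w) (here refl) k with joins-determined j k
  ... | inj₁ (refl , refl) = there (here refl) , vertices-step w (source∈vertices w)
  ... | inj₂ (refl , refl) = vertices-step w (source∈vertices w) , there (here refl)
  endpoints∈vertices (step e j w) (there i) k =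
    let p , q = endpoints∈vertices w i k in vertices-step w p , vertices-step w q

  Simple : Walk u v → Set
  Simple w = Unique (edges w) × Unique (vertices w)

  SimplePath : EdgeSet → Vertex → Vertex → Set
  SimplePath P u v = ∃[ w ] All P (edges {u} {v} w) × Simple w

  suffixFrom : (w : Walk u v) → All P (edges w) → Simple w → x ∈ₗ vertices w → SimplePath P x v
  suffixFrom w _ _ (here refl) = stop , [] , [] , [] ∷ []
  suffixFrom (step e j w) Ps S (there (here refl)) = step e j w , Ps , S
  suffixFrom (step e j w) (_ ∷ Ps) (_ ∷ es , (_ ∷ v∉) ∷ _ ∷ vs) (there (there i)) =
    suffixFrom w Ps (es , v∉ ∷ vs) (there i)

  module _ (_≟_ : DecidableEquality Vertex) where
    open DecMembership _≟_ using (_∈?_)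

    -- Loop erasure from the far end: if the new first vertex already occurs, the path is cut back
    -- to start there. Otherwise the new edge is new as well, since both ends of every used edge are
    -- among the `vertices`.
    simplePath : Conn P u v → SimplePath P u v
    simplePath ε = stop , [] , [] , [] ∷ []
    simplePath {u = u} ((e , Pe , j) ◅ c) with simplePath c
    ... | w , Ps , S@(es , v∉ ∷ vs) with u ∈? vertices w
    ... | yes u∈ = suffixFrom w Ps S u∈
    ... | no  u∉ =
      step e j w , Pe ∷ Ps ,
      All.tabulate (λ { i refl → u∉ (proj₁ (endpoints∈vertices w i j)) }) ∷ es ,
      ((λ { refl → u∉ (here refl) }) ∷ v∉) ∷ All.tabulate (λ { i refl → u∉ (there i) }) ∷ vs

    -- A path between the ends of `e` that avoids `e`, once made simple, closes up with `e` into a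
    -- cycle.
    spanningTree⇒basis : ∀ {p} → IsSpanningTree p → IsBasis (λ e → lookup p e ≡ true)
    spanningTree⇒basis {p} (connected , acyclic) = record
      { spanning    = λ u v → let w , ps = connected u v in conn w ps
      ; independent = indep
      }
      where
      conn : (w : Walk u v) → Within p w → Conn (λ e → lookup p e ≡ true) u v
      conn stop         []       = ε
      conn (step e j w) (i ∷ is) = (e , []=⇒lookup i , j) ◅ conn w is

      indep : lookup p e ≡ true → Joins e u v → ¬ Conn ((λ e → lookup p e ≡ true) ∖ e) u v
      indep pe j c with simplePath (conn-sym c)
      ... | w , Ps , es , vs =
        acyclic (step _ j w) (lookup⇒[]= _ p pe ∷ All.map (lookup⇒[]= _ p ∘ proj₁) Ps)
          ((λ ()) , All.map (λ (_ , f≢e) e≡f → f≢e (sym e≡f)) Ps ∷ es , vs)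

    -- The first edge from `A` to `B` will do. As no edge is repeated, the stretches before and
    -- after it avoid it.
    crossingEdge : {A B : Vertex → Set} → (∀ y → A y ⊎ B y) → (∀ y → A y → B y → ⊥) →
      (w : Walk x y) → Unique (edges w) → A x → B y →
      ∃[ f ] ∃[ u ] ∃[ v ] f ∈ₗ edges w × Joins f u v × A u × B v ×
        Conn ((_∈ₗ edges w) ∖ f) x u × Conn ((_∈ₗ edges w) ∖ f) v y
    crossingEdge side disjoint stop _ Ax By = contradiction By (disjoint _ Ax)
    crossingEdge side disjoint (step {v = z} e j w) (e∉ ∷ es) Ax By with side z
    ... | inj₂ Bz = e , _ , _ , here refl , j , Ax , Bz , ε , avoiding w (All.map (λ e≢f f≡e → e≢f (sym f≡e)) e∉) there
      where
      avoiding : ∀ {u v} (w : Walk u v) → All (_≢ e) (edges w) → (∀ {f} → f ∈ₗ edges w → P f) → Conn (P ∖ e) u v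
      avoiding stop _ _ = ε
      avoiding (step f k w) (f≢e ∷ ≢s) in-P = (f , (in-P (here refl) , f≢e) , k) ◅ avoiding w ≢s (in-P ∘ there)
    ... | inj₁ Az with crossingEdge side disjoint w es Az By
    ... | f , u , v , f∈ , k , Au , Bv , c , d =
      f , u , v , there f∈ , k , Au , Bv ,
      (e , (here refl , All.lookup e∉ f∈) , j) ◅ conn-mono later c , conn-mono later d
      where
      later : ((_∈ₗ edges w) ∖ f) ⊆ ((_∈ₗ e ∷ edges w) ∖ f)
      later (i , ≢f) = there i , ≢f

    -- In the tree Q the ends of e are joined by a path; some edge f of that
    -- path has to cross between the two parts of P ∖ e.
    symmetricExchange : IsBasis P → IsBasis Q → P e → ¬ Q e →
      ∃[ f ] Q f × ¬ P f × IsBasis (P [ e ↦ f ]) × IsBasis (Q [ f ↦ e ])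
    symmetricExchange {P} {Q} {e} BP BQ Pe ¬Qe = exchange
      where
      s t : Vertex
      s = proj₁ (endpoints e)
      t = proj₂ (endpoints e)

      st : Joins e s t
      st = inj₁ refl

      side : ∀ y → Conn (P ∖ e) s y ⊎ Conn (P ∖ e) t y
      side y with removeEdge st (spanning BP s y)
      ... | inj₁ c              = inj₁ c
      ... | inj₂ (inj₁ (_ , c)) = inj₂ c
      ... | inj₂ (inj₂ (_ , c)) = inj₁ c

      disjoint : ∀ y → Conn (P ∖ e) s y → Conn (P ∖ e) t y → ⊥
      disjoint y sy ty = independent BP Pe st (sy ◅◅ conn-sym ty)

      exchange : ∃[ f ] Q f × ¬ P f × IsBasis (P [ e ↦ f ]) × IsBasis (Q [ f ↦ e ])
      exchange with simplePath (spanning BQ s t)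
      ... | w , Qs , es , _ with crossingEdge side disjoint w es ε ε
      ... | f , u , v , f∈ , k , su , tv , c , d =
        f , Qf ,
        -- An `f` in `P` would join the two parts of `P` without `e`; it differs from `e`, which is
        -- not in `Q`.
        (λ Pf → disjoint v (su ◅◅ joined (Pf , λ { refl → ¬Qe Qf }) k) tv) ,
        replaceEdge BP Pe st k su (conn-sym tv) ,
        -- Without `f` the path in `Q` falls into two pieces, leading from the ends of `f` to those
        -- of `e`.
        replaceEdge BQ Qf k st (conn-sym (conn-mono in-Q c)) (conn-sym (conn-mono in-Q d))
        where
        Qf : Q f
        Qf = All.lookup Qs f∈

        in-Q : ((_∈ₗ edges w) ∖ f) ⊆ (Q ∖ f)
        in-Q (i , ≢f) = All.lookup Qs i , ≢f

private variable
  n : ℕ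

-- Recurrence of an injective map on a finite set.

module _ {A : Set} (f : A → A) (f-injective : ∀ {x y} → f x ≡ f y → x ≡ y) where

  iterate-suc : ∀ x k → iterate f (f x) k ≡ f (iterate f x k)
  iterate-suc x zero    = refl
  iterate-suc x (suc k) = iterate-suc (f x) k

  iterate-cancel : ∀ x i k → iterate f x i ≡ iterate f x (i + k) → x ≡ iterate f x k
  iterate-cancel x zero    k eq = eq
  iterate-cancel x (suc i) k eq = iterate-cancel x i k
    (f-injective (trans (sym (iterate-suc x i)) (trans eq (iterate-suc x (i + k)))))

  -- By pigeonhole two iterates agree, and injectivity cancels their common steps. The form
  -- `iterate f (f x) k` makes the number of steps positive.
  returns : (code : A → Fin n) → (∀ {x y} → code x ≡ code y → x ≡ y) →
            ∀ x → ∃[ k ] x ≡ iterate f (f x) k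
  returns code code-injective x
    with Fin.pigeonhole (ℕ.n<1+n _) (λ i → code (iterate f x (toℕ i)))
  ... | i , j , i<j , eq with ℕ.m≤n⇒∃[o]m+o≡n i<j
  ... | k , i+k≡j = k , iterate-cancel x (toℕ i) (suc k)
    (trans (code-injective eq) (cong (iterate f x) (trans (sym i+k≡j) (sym (ℕ.+-suc (toℕ i) k)))))

-- The four ends of a crossing under the two smoothings.

opp : Fin 4 → Fin 4
opp i = ccw (ccw i)

opp-involutive : ∀ i → opp (opp i) ≡ i
opp-involutive 0F = refl
opp-involutive 1F = refl
opp-involutive 2F = refl
opp-involutive 3F = refl

opp≢ : ∀ i → opp i ≢ i
opp≢ 0F ()
opp≢ 1F ()
opp≢ 2F ()
opp≢ 3F ()

opp-cw : ∀ j → opp (cw j) ≡ ccw j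
opp-cw 0F = refl
opp-cw 1F = refl
opp-cw 2F = refl
opp-cw 3F = refl

ccw-cw : ∀ j → ccw (cw j) ≡ j
ccw-cw 0F = refl
ccw-cw 1F = refl
ccw-cw 2F = refl
ccw-cw 3F = refl

flip : Smoothing → Smoothing
flip horizontal = vertical
flip vertical   = horizontal

flip-involutive : ∀ m → flip (flip m) ≡ m
flip-involutive horizontal = refl
flip-involutive vertical   = refl

partner : Smoothing → Fin 4 → Fin 4
partner horizontal 0F = 1F
partner horizontal 1F = 0F
partner horizontal 2F = 3F
partner horizontal 3F = 2F
partner vertical   0F = 3F
partner vertical   1F = 2F
partner vertical   2F = 1F
partner vertical   3F = 0F

partner-involutive : ∀ m j → partner m (partner m j) ≡ j
partner-involutive horizontal 0F = refl
partner-involutive horizontal 1F = refl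
partner-involutive horizontal 2F = refl
partner-involutive horizontal 3F = refl
partner-involutive vertical   0F = refl
partner-involutive vertical   1F = refl
partner-involutive vertical   2F = refl
partner-involutive vertical   3F = refl

-- Each smoothing joins `j` to one of its two neighbours, and these are opposite ends.
partner-flip : ∀ m j → partner (flip m) j ≡ opp (partner m j)
partner-flip horizontal 0F = refl
partner-flip horizontal 1F = refl
partner-flip horizontal 2F = refl
partner-flip horizontal 3F = refl
partner-flip vertical   0F = refl
partner-flip vertical   1F = refl
partner-flip vertical   2F = refl
partner-flip vertical   3F = refl

partner-adjacent : ∀ m j → partner m j ≡ cw j ⊎ partner m j ≡ ccw j
partner-adjacent horizontal 0F = inj₂ refl
partner-adjacent horizontal 1F = inj₁ refl
partner-adjacent horizontal 2F = inj₂ refl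
partner-adjacent horizontal 3F = inj₁ refl
partner-adjacent vertical   0F = inj₁ refl
partner-adjacent vertical   1F = inj₂ refl
partner-adjacent vertical   2F = inj₁ refl
partner-adjacent vertical   3F = inj₂ refl

joint-partner : ∀ {m i j} → Joint (just m) i j → j ≡ partner m i
joint-partner h₀₁ = refl
joint-partner h₂₃ = refl
joint-partner v₁₂ = refl
joint-partner v₃₀ = refl

partner-joint : ∀ m j → Joint (just m) j (partner m j) ⊎ Joint (just m) (partner m j) j
partner-joint horizontal 0F = inj₁ h₀₁
partner-joint horizontal 1F = inj₂ h₀₁
partner-joint horizontal 2F = inj₁ h₂₃
partner-joint horizontal 3F = inj₂ h₂₃
partner-joint vertical   0F = inj₂ v₃₀
partner-joint vertical   1F = inj₁ v₁₂
partner-joint vertical   2F = inj₂ v₁₂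
partner-joint vertical   3F = inj₁ v₃₀

-- Strands and circles of a smoothed diagram.

module Circles (D : Shadow) (χ : Checkerboard D) where
  open Shadow D
  open Checkerboard χ
  open Trees (blackGraph D χ)
  open Multigraph (blackGraph D χ) using (Joins)

  private variable
    σ σ′ : Fin crossings → Smoothing
    c e : Fin crossings
    x y r : End crossings
    i i′ : Fin 4

  -- The arc at a black end has the black region on its left when it is
  -- traversed away from the crossing.
  Black : End crossings → Set
  Black x = colour (region x) ≡ black

  black? : ∀ x → Black x ⊎ colour (region x) ≡ white
  black? x with colour (region x)
  ... | black = inj₁ refl
  ... | white = inj₂ refl

  ¬black-white : ¬ Black x → colour (region x) ≡ white
  ¬black-white {x} ¬b = [ (λ b → contradiction b ¬b) , id ]′ (black? x)

  opposite-involutive : ∀ k → opposite (opposite k) ≡ k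
  opposite-involutive black = refl
  opposite-involutive white = refl

  colour-opp : ∀ c i → colour (region (c , opp i)) ≡ colour (region (c , i))
  colour-opp c i = trans (alternating c (ccw i))
    (trans (cong opposite (alternating c i)) (opposite-involutive _))

  black-ccw : Black (c , i) → ¬ Black (c , ccw i)
  black-ccw {c} {i} b b′ with trans (sym b′) (trans (alternating c i) (cong opposite b))
  ... | ()

  oppEnd : End crossings → End crossings
  oppEnd (c , i) = c , opp i

  black-opp : Black x → Black (oppEnd x)
  black-opp {x = c , i} b = trans (colour-opp c i) b

  black-ends : Black (c , i) → Black (c , i′) → i′ ≡ i ⊎ i′ ≡ opp i
  black-ends {i = 0F} {0F} _ _ = inj₁ refl
  black-ends {i = 0F} {1F} b b′ = contradiction b′ (black-ccw b)
  black-ends {i = 0F} {2F} _ _ = inj₂ refl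
  black-ends {i = 0F} {3F} b b′ = contradiction b (black-ccw b′)
  black-ends {i = 1F} {0F} b b′ = contradiction b (black-ccw b′)
  black-ends {i = 1F} {1F} _ _ = inj₁ refl
  black-ends {i = 1F} {2F} b b′ = contradiction b′ (black-ccw b)
  black-ends {i = 1F} {3F} _ _ = inj₂ refl
  black-ends {i = 2F} {0F} _ _ = inj₂ refl
  black-ends {i = 2F} {1F} b b′ = contradiction b (black-ccw b′)
  black-ends {i = 2F} {2F} _ _ = inj₁ refl
  black-ends {i = 2F} {3F} b b′ = contradiction b′ (black-ccw b)
  black-ends {i = 3F} {0F} b b′ = contradiction b′ (black-ccw b)
  black-ends {i = 3F} {1F} _ _ = inj₂ refl
  black-ends {i = 3F} {2F} b b′ = contradiction b (black-ccw b′)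
  black-ends {i = 3F} {3F} _ _ = inj₁ refl

  region-next : ∀ x → region (nextCorner arc x) ≡ region x
  region-next x = sym (Equivalence.from (region-orbit x (nextCorner arc x)) (fwd (next x) ◅ ε))

  black-next : Black x → Black (nextCorner arc x)
  black-next {x} b = trans (cong colour (region-next x)) b

  -- The corner just clockwise of the arrival end belongs to the same black region, so the arrival
  -- end itself is white. With `¬black-arc`, the black ends orient every arc.
  black-arc : Black x → ¬ Black (arc x)
  black-arc {x} b b′ with arc x in eq
  ... | c , j = black-ccw (subst Black (cong (λ (c , j) → c , cw j) eq) (black-next b))
    (subst (λ j → Black (c , j)) (sym (ccw-cw j)) b′)

  ¬black-arc : ¬ Black x → Black (arc x)
  ¬black-arc {x} ¬b =
    trans (cong (λ j → colour (region (proj₁ (arc x) , j))) (sym (ccw-cw (proj₂ (arc x)))))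
      (trans (alternating _ _) (cong opposite (trans (cong colour (region-next x)) (¬black-white ¬b))))

  -- The strand leaving along the end x, followed up to the end along which it
  -- leaves the next crossing.
  φ : (Fin crossings → Smoothing) → End crossings → End crossings
  φ σ x = let (c , j) = arc x in c , partner (σ c) j

  arc-injective : arc x ≡ arc y → x ≡ y
  arc-injective {x} {y} eq = trans (sym (arc-involutive x)) (trans (cong arc eq) (arc-involutive y))

  joined-end : (Fin crossings → Smoothing) → End crossings → End crossings
  joined-end σ (c , j) = c , partner (σ c) j

  joined-end-involutive : ∀ σ x → joined-end σ (joined-end σ x) ≡ x
  joined-end-involutive σ (c , j) = cong (c ,_) (partner-involutive (σ c) j)

  φ-injective : φ σ x ≡ φ σ y → x ≡ y
  φ-injective {σ} eq = arc-injective
    (trans (sym (joined-end-involutive σ _)) (trans (cong (joined-end σ) eq) (joined-end-involutive σ _)))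

  -- Both neighbours of the arrival end are black, so strands respect the orientation whatever the
  -- smoothing.
  black-φ : ∀ σ → Black x → Black (φ σ x)
  black-φ {x} σ b with partner-adjacent (σ (proj₁ (arc x))) (proj₂ (arc x))
  ... | inj₁ eq = subst (λ j → Black (_ , j)) (sym eq) (black-next b)
  ... | inj₂ eq = subst (λ j → Black (_ , j)) (trans (opp-cw _) (sym eq)) (black-opp (black-next b))

  -- The target `c` stays fixed while `x` moves along the strand, so `x` need not lie at `c`. The
  -- smoothing at `c` is used in the last step only.
  data FirstReturn (σ : Fin crossings → Smoothing) (c : Fin crossings) : End crossings → End crossings → Set where
    arrive : proj₁ (φ σ x) ≡ c → FirstReturn σ c x (φ σ x)
    pass   : proj₁ (φ σ x) ≢ c → FirstReturn σ c (φ σ x) r → FirstReturn σ c x r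

  -- `φ` is injective on finitely many ends, so the strand comes back to `x` itself; this bounds the
  -- search for the first visit to its crossing.
  firstReturn : ∀ σ x → ∃[ r ] FirstReturn σ (proj₁ x) x r
  firstReturn σ x =
    let k , eq = returns (φ σ) (φ-injective {σ}) (λ (c , i) → combine c i) code-injective x
    in search k x (cong proj₁ (sym eq))
    where
    code-injective : ∀ {x y : End crossings} → combine (proj₁ x) (proj₂ x) ≡ combine (proj₁ y) (proj₂ y) → x ≡ y
    code-injective {c , i} {c′ , i′} eq with Fin.combine-injective c i c′ i′ eq
    ... | refl , refl = refl

    search : ∀ k y → proj₁ (iterate (φ σ) (φ σ y) k) ≡ proj₁ x → ∃[ r ] FirstReturn σ (proj₁ x) y r
    search k y at-c with proj₁ (φ σ y) Fin.≟ proj₁ x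
    ... | yes p = _ , arrive p
    search zero    y at-c | no ¬p = contradiction at-c ¬p
    search (suc k) y at-c | no ¬p = let r , R = search k (φ σ y) at-c in r , pass ¬p R

  returns-at : FirstReturn σ c x r → proj₁ r ≡ c
  returns-at (arrive p) = p
  returns-at (pass _ R) = returns-at R

  black-return : Black x → FirstReturn σ c x r → Black r
  black-return {σ = σ} b (arrive _) = black-φ σ b
  black-return {σ = σ} b (pass _ R) = black-return (black-φ σ b) R

  -- A crossing has only two black ends, opposite to each other. Flipping the smoothing there
  -- exchanges the two cases.
  firstReturn-black : ∀ σ → Black x → FirstReturn σ (proj₁ x) x x ⊎ FirstReturn σ (proj₁ x) x (oppEnd x)
  firstReturn-black {x} σ b with firstReturn σ x
  ... | r , R with returns-at R
  ... | refl with black-ends b (black-return b R)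
  ... | inj₁ refl = inj₁ R
  ... | inj₂ refl = inj₂ R

  -- A change of smoothing at c does not affect a strand before it arrives at c.
  firstReturn-change : (g : Fin 4 → Fin 4) → (∀ j → partner (σ′ c) j ≡ g (partner (σ c) j)) →
    (∀ d → d ≢ c → σ′ d ≡ σ d) → FirstReturn σ c x r → FirstReturn σ′ c x (proj₁ r , g (proj₂ r))
  firstReturn-change {σ′} {c} {x = x} g at-c off-c (arrive refl) =
    subst (FirstReturn σ′ c x) (cong (c ,_) (at-c _)) (arrive refl)
  firstReturn-change {σ′} {c} {r = r} g at-c off-c (pass ¬p R) =
    pass ¬p (subst (λ m → FirstReturn σ′ c (_ , partner m _) (proj₁ r , g (proj₂ r))) (sym (off-c _ ¬p))
      (firstReturn-change g at-c off-c R))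

  firstReturn-flip : σ′ c ≡ flip (σ c) → (∀ d → d ≢ c → σ′ d ≡ σ d) →
    FirstReturn σ c x r → FirstReturn σ′ c x (oppEnd r)
  firstReturn-flip {σ = σ} at-c = firstReturn-change opp
    (λ j → trans (cong (λ m → partner m j) at-c) (partner-flip (σ _) j))

  -- The start is listed and the return end is left out, so that a closed strand is listed once
  -- round.
  Strand : (σ : Fin crossings → Smoothing) → FirstReturn σ c x r → End crossings → Set
  Strand {x = x} σ (arrive _) y = y ≡ x
  Strand {x = x} σ (pass _ R) y = y ≡ x ⊎ Strand σ R y

  strand-start : (R : FirstReturn σ c x r) → Strand σ R x
  strand-start (arrive _) = refl
  strand-start (pass _ _) = inj₁ refl

  strand-next : (R : FirstReturn σ c x r) → Strand σ R y → φ σ y ≡ r ⊎ Strand σ R (φ σ y)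
  strand-next (arrive _) refl        = inj₁ refl
  strand-next (pass _ R) (inj₁ refl) = inj₂ (inj₂ (strand-start R))
  strand-next (pass _ R) (inj₂ s)    = Sum.map₂ inj₂ (strand-next R s)

  strand-end : (R : FirstReturn σ c x r) → ∃[ z ] Strand σ R z × φ σ z ≡ r
  strand-end (arrive _) = _ , refl , refl
  strand-end (pass _ R) = let z , s , eq = strand-end R in z , inj₂ s , eq

  strand-previous : (R : FirstReturn σ c x r) → Strand σ R y → y ≡ x ⊎ ∃[ z ] Strand σ R z × φ σ z ≡ y
  strand-previous (arrive _) s        = inj₁ s
  strand-previous (pass _ R) (inj₁ s) = inj₁ s
  strand-previous (pass _ R) (inj₂ s) with strand-previous R s
  ... | inj₁ refl         = inj₂ (_ , inj₁ refl , refl)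
  ... | inj₂ (z , t , eq) = inj₂ (z , inj₂ t , eq)

  strand-avoids : (R : FirstReturn σ c x r) → Strand σ R y → y ≡ x ⊎ proj₁ y ≢ c
  strand-avoids (arrive _)  s        = inj₁ s
  strand-avoids (pass _ R)  (inj₁ s) = inj₁ s
  strand-avoids (pass ¬p R) (inj₂ s) with strand-avoids R s
  ... | inj₁ refl = inj₂ ¬p
  ... | inj₂ ¬q   = inj₂ ¬q

  strand-black : (R : FirstReturn σ c x r) → Black x → Strand σ R y → Black y
  strand-black (arrive _) b refl            = b
  strand-black (pass _ R) b (inj₁ refl)     = b
  strand-black {σ = σ} (pass _ R) b (inj₂ s) = strand-black R (black-φ σ b) s

  Smoothed : Position crossings → (Fin crossings → Smoothing) → Set
  Smoothed s σ = ∀ c → lookup s c ≡ just (σ c)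

  -- A strand returning to its start is a circle missing the opposite end.
  closedStrand⇒disconnected : ∀ {s} → Smoothed s σ → Black x → FirstReturn σ (proj₁ x) x x →
    ¬ ConnectedDiagram arc s
  closedStrand⇒disconnected {σ} {x} {s} smoothed b R connected =
    -- The strand leaves its crossing only along `x`, so the opposite end is not on it; nor is the
    -- other end of that arc, which is not black.
    [ start-only ∘ strand-avoids R
    , (λ t → black-arc (black-opp b) (strand-black R b t))
    ]′ (closed (connected x (oppEnd x)) (inj₁ (strand-start R)))
    where
    -- The strand lists only the black end of each arc; the circle has both.
    Circle : End crossings → Set
    Circle y = Strand σ R y ⊎ Strand σ R (arc y)

    start-only : ¬ (oppEnd x ≡ x ⊎ proj₁ x ≢ proj₁ x)
    start-only (inj₁ eq)  = opp≢ _ (cong proj₂ eq)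
    start-only (inj₂ neq) = neq refl

    circle-arc : ∀ y → Circle y → Circle (arc y)
    circle-arc y (inj₁ s) = inj₂ (subst (Strand σ R) (sym (arc-involutive y)) s)
    circle-arc y (inj₂ s) = inj₁ s

    next-on : ∀ {y} → Strand σ R y → Strand σ R (φ σ y)
    next-on s with strand-next R s
    ... | inj₁ eq = subst (Strand σ R) (sym eq) (strand-start R)
    ... | inj₂ t  = t

    previous-on : ∀ {y} → Strand σ R y → ∃[ z ] Strand σ R z × φ σ z ≡ y
    previous-on s with strand-previous R s
    ... | inj₁ refl = strand-end R
    ... | inj₂ t    = t

    -- Either the strand arrives at `y` and leaves along the partner, or it leaves along `y` after
    -- arriving at the partner.
    circle-joined : ∀ y → Circle y → Circle (joined-end σ y)
    circle-joined y (inj₂ t) = inj₁ (subst (Strand σ R) (cong (joined-end σ) (arc-involutive y)) (next-on t))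
    circle-joined y (inj₁ t) with previous-on t
    ... | z , t′ , refl = inj₂ (subst (Strand σ R)
      (sym (trans (cong arc (joined-end-involutive σ (arc z))) (arc-involutive z))) t′)

    joint-end : ∀ {d i j} → Joint (lookup s d) i j → (d , j) ≡ joined-end σ (d , i)
    joint-end {d} k = cong (d ,_) (joint-partner (subst (λ m → Joint m _ _) (smoothed d) k))

    forwards : ∀ {y z} → Adjacent arc s y z → Circle y → Circle z
    forwards (along y)      = circle-arc y
    forwards (at d {i} {j} k) t = subst Circle (sym (joint-end k)) (circle-joined (d , i) t)

    backwards : ∀ {y z} → Adjacent arc s y z → Circle z → Circle y
    backwards (along y)      t = subst Circle (arc-involutive y) (circle-arc (arc y) t)
    backwards (at d {i} {j} k) t = subst Circle
      (trans (cong (joined-end σ) (joint-end k)) (joined-end-involutive σ (d , i)))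
      (circle-joined (d , j) t)

    closed : ∀ {y z} → EqClosure (Adjacent arc s) y z → Circle y → Circle z
    closed ε            t = t
    closed (fwd a ◅ as) t = closed as (forwards a t)
    closed (bwd a ◅ as) t = closed as (backwards a t)

  -- If the strand from a black end of `c` does not close up, flipping `c` closes it. The claim
  -- covers every `τ` that agrees with `σ` off `c`, since before the last move `σ c` is only a
  -- placeholder.
  disconnectingSmoothing : ∀ c σ → ∃[ m ] ∀ {s τ} → Smoothed s τ → τ c ≡ m → (∀ d → d ≢ c → τ d ≡ σ d) →
    ¬ ConnectedDiagram arc s
  disconnectingSmoothing c σ with blackCorner D χ c
  ... | i , b with firstReturn-black σ b
  ... | inj₁ R = σ c , λ smoothed at-c off-c → closedStrand⇒disconnected smoothed b
    (firstReturn-change id (λ j → cong (λ m → partner m j) at-c) off-c R)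
  ... | inj₂ R = flip (σ c) , λ smoothed at-c off-c → closedStrand⇒disconnected smoothed b
    (subst (FirstReturn _ c (c , i)) (cong (c ,_) (opp-involutive i)) (firstReturn-flip at-c off-c R))

  -- Circles of the diagram and components of the contracted edges.

  vertex : ∀ x → Black x → BlackRegion D χ
  vertex x b = region x , b

  blackRegion-≡ : {u v : BlackRegion D χ} → proj₁ u ≡ proj₁ v → u ≡ v
  blackRegion-≡ {r , p} {.r , q} refl = cong (r ,_) (irrelevant p q)
    where
    irrelevant : ∀ {k} (p q : k ≡ black) → p ≡ q
    irrelevant refl refl = refl

  -- The endpoints are listed from a chosen black corner; starting from the other one swaps them.
  joins-black : (b : Black (c , i)) → Joins c (vertex (c , i) b) (vertex (c , opp i) (black-opp b))
  joins-black {c} {i} b with blackCorner D χ c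
  ... | j , b′ with black-ends b′ b
  ... | inj₁ refl = inj₁ (cong₂ _,_ (blackRegion-≡ refl) (blackRegion-≡ refl))
  ... | inj₂ refl = inj₂ (cong₂ _,_ (blackRegion-≡ (cong (λ k → region (c , k)) (sym (opp-involutive j)))) (blackRegion-≡ refl))

  -- The smoothing that merges the two black corners: `vertical` opens a passage between the corners
  -- `0F` and `2F`, `horizontal` between `1F` and `3F`. The argument is the colour of the corner
  -- `0F`.
  contracting : Colour → Smoothing
  contracting black = vertical
  contracting white = horizontal

  contract delete : Fin crossings → Smoothing
  contract c = contracting (colour (region (c , 0F)))
  delete c = flip (contract c)

  contract-or-delete : ∀ c m → m ≡ contract c ⊎ m ≡ delete c
  contract-or-delete c m with contract c
  contract-or-delete c horizontal | horizontal = inj₁ refl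
  contract-or-delete c vertical   | horizontal = inj₂ refl
  contract-or-delete c horizontal | vertical   = inj₂ refl
  contract-or-delete c vertical   | vertical   = inj₁ refl

  -- Deleting keeps the two black corners apart, so the strand goes on along the boundary of the
  -- black region on its left. The colour at `0F`, on which `delete` depends, is recovered from that
  -- at `cw j`.
  delete-partner : ∀ j → Black (c , cw j) → partner (delete c) j ≡ cw j
  delete-partner {c} 0F b rewrite trans (alternating c 3F) (cong opposite b) = refl
  delete-partner {c} 1F b rewrite b = refl
  delete-partner {c} 2F b with colour (region (c , 0F)) in eq
  ... | black = contradiction b (black-ccw eq)
  ... | white = refl
  delete-partner {c} 3F b rewrite trans (sym (colour-opp c 0F)) b = refl

  contract-partner : ∀ j → Black (c , cw j) → partner (contract c) j ≡ ccw j
  contract-partner {c} j b with contract c | delete-partner j b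
  ... | m | eq = trans (sym (opp-involutive _)) (trans (cong opp (trans (sym (partner-flip m j)) eq)) (opp-cw j))

  φ-deleted : Black x → σ (proj₁ (arc x)) ≡ delete (proj₁ (arc x)) → φ σ x ≡ nextCorner arc x
  φ-deleted {x} b eq = cong (_ ,_)
    (trans (cong (λ m → partner m (proj₂ (arc x))) eq) (delete-partner (proj₂ (arc x)) (black-next b)))

  -- Through the passage between the two black corners the strand goes on along the boundary on the
  -- far side of the edge.
  φ-contracted : Black x → σ (proj₁ (arc x)) ≡ contract (proj₁ (arc x)) → φ σ x ≡ oppEnd (nextCorner arc x)
  φ-contracted {x} b eq = cong (_ ,_)
    (trans (cong (λ m → partner m (proj₂ (arc x))) eq)
      (trans (contract-partner (proj₂ (arc x)) (black-next b)) (sym (opp-cw (proj₂ (arc x))))))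

  -- A list, so that an induction can contract edges one at a time, starting from all deleted.
  contractAll : List (Fin crossings) → Fin crossings → Smoothing
  contractAll []      c = delete c
  contractAll (e ∷ X) c with c Fin.≟ e
  ... | yes _ = contract c
  ... | no  _ = contractAll X c

  contractAll-∈ : ∀ {X} → c ∈ₗ X → contractAll X c ≡ contract c
  contractAll-∈ {c} {e ∷ X} i with c Fin.≟ e
  contractAll-∈ i         | yes _  = refl
  contractAll-∈ (here p)  | no ¬p = contradiction p ¬p
  contractAll-∈ (there i) | no _  = contractAll-∈ i

  contractAll-∉ : ∀ {X} → c ∉ₗ X → contractAll X c ≡ delete c
  contractAll-∉ {X = []} _ = refl
  contractAll-∉ {c} {e ∷ X} ∉ with c Fin.≟ e
  ... | yes p = contradiction (here p) ∉
  ... | no  _ = contractAll-∉ (∉ ∘ there)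

  contractAll-at : ∀ e X → contractAll (e ∷ X) e ≡ contract e
  contractAll-at e X = contractAll-∈ {X = e ∷ X} (here refl)

  contractAll-off : ∀ {e} X c → c ≢ e → contractAll (e ∷ X) c ≡ contractAll X c
  contractAll-off {e} X c c≢e with c Fin.≟ e
  ... | yes p = contradiction p c≢e
  ... | no _  = refl

  open DecMembership (Fin._≟_ {crossings}) using (_∈?_)

  -- A strand stays within a component: at a deleted edge it keeps its region, at a contracted one
  -- it moves to the other endpoint.
  φ-conn : ∀ X (b : Black x) (b′ : Black (φ (contractAll X) x)) → Conn (_∈ₗ X) (vertex x b) (vertex _ b′)
  φ-conn {x} X b b′ with proj₁ (arc x) ∈? X
  ... | no ∉ = subst (Conn (_∈ₗ X) _)
    (blackRegion-≡ (trans (sym (region-next x))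
      (cong region (sym (φ-deleted {σ = contractAll X} b (contractAll-∉ ∉)))))) ε
  ... | yes i = subst₂ (Conn (_∈ₗ X))
    (blackRegion-≡ (region-next x))
    (blackRegion-≡ (cong region (sym (φ-contracted {σ = contractAll X} b (contractAll-∈ i)))))
    (joined i (joins-black (black-next b)))

  return-conn : ∀ X (b : Black x) (b′ : Black r) → FirstReturn (contractAll X) c x r →
    Conn (_∈ₗ X) (vertex x b) (vertex r b′)
  return-conn X b b′ (arrive _) = φ-conn X b b′
  return-conn X b b′ (pass _ R) = φ-conn X b b″ ◅◅ return-conn X b″ b′ R
    where b″ = black-φ (contractAll X) b

  Follows : (Fin crossings → Smoothing) → End crossings → End crossings → Set
  Follows σ x y = Black x × φ σ x ≡ y

  SameCircle : (Fin crossings → Smoothing) → End crossings → End crossings → Set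
  SameCircle σ = EqClosure (Follows σ)

  return-sameCircle : Black x → FirstReturn σ c x r → SameCircle σ x r
  return-sameCircle b (arrive _) = fwd (b , refl) ◅ ε
  return-sameCircle {σ = σ} b (pass _ R) = fwd (b , refl) ◅ return-sameCircle (black-φ σ b) R

  -- Acyclicity edge by edge: the head is contracted last and joins two components of the tail.
  data Independent : List (Fin crossings) → Set where
    []  : Independent []
    _∷_ : ∀ {e X} → (∀ {u v} → Joins e u v → ¬ Conn (_∈ₗ X) u v) → Independent X → Independent (e ∷ X)

  -- With all edges deleted the circles bound the black regions; contracting an
  -- edge between different components merges the two circles passing it.
  conn⇒sameCircle : ∀ {X} → Independent X → (b : Black x) (b′ : Black y) →
    Conn (_∈ₗ X) (vertex x b) (vertex y b′) → SameCircle (contractAll X) x y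
  conn⇒sameCircle {x} {y} [] b b′ c =
    boundary b (Equivalence.to (region-orbit x y) (cong proj₁ (no-edges c)))
    where
    no-edges : ∀ {u v} → Conn (_∈ₗ []) u v → u ≡ v
    no-edges ε                  = refl
    no-edges ((_ , () , _) ◅ _)

    deleted : ∀ {x} → Black x → φ (contractAll []) x ≡ nextCorner arc x
    deleted b = φ-deleted {σ = contractAll []} b refl

    boundary : ∀ {x y} → Black x → EqClosure (SameRegion₁ arc) x y → SameCircle (contractAll []) x y
    boundary b ε                   = ε
    boundary b (fwd (next x) ◅ ss) = fwd (b , deleted b) ◅ boundary (black-next b) ss
    boundary b (bwd (next x) ◅ ss) = bwd (bx , deleted bx) ◅ boundary bx ss
      where
      bx : Black x
      bx = trans (cong colour (sym (region-next x))) b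
  conn⇒sameCircle {x} {y} {e ∷ X} (separated ∷ I) b b′ c = [ old b b′ , [ via , via′ ]′ ]′ (removeEdge pq (conn-mono id c))
    where
    before after : Fin crossings → Smoothing
    before = contractAll X
    after  = contractAll (e ∷ X)

    p q : End crossings
    p = e , proj₁ (blackCorner D χ e)
    q = oppEnd p

    bp : Black p
    bp = proj₂ (blackCorner D χ e)

    bq : Black q
    bq = black-opp bp

    pq : Joins e (vertex p bp) (vertex q bq)
    pq = joins-black bp

    e∉X : e ∉ₗ X
    e∉X i = separated pq (joined i pq)

    flipped : after e ≡ flip (before e)
    flipped = trans (contractAll-at e X)
      (trans (sym (flip-involutive (contract e))) (cong flip (sym (contractAll-∉ e∉X))))

    merged : SameCircle after p q
    -- Before the contraction the strand from `p` cannot come back at `q`, for that would connect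
    -- the ends of `e` within `X`. So it closes up at `p`, and the flip sends it to `q`.
    merged with firstReturn-black before bp
    ... | inj₁ R = return-sameCircle bp (firstReturn-flip {σ = before} flipped (contractAll-off X) R)
    ... | inj₂ R = contradiction (return-conn X bp bq R) (separated pq)

    onward : ∀ {x} → Black x → SameCircle after x (φ before x)
    onward {x} b with proj₁ (arc x) Fin.≟ e
    ... | no ≢e = fwd (b , cong (λ m → _ , partner m _) (contractAll-off X _ ≢e)) ◅ ε
    -- At `e` the strand now leaves along the opposite end, but both black ends of `e` lie on the
    -- merged circle.
    ... | yes refl = fwd (b , eq) ◅ opposite-end (black-φ before b)
      where
      eq : φ after x ≡ oppEnd (φ before x)
      eq = cong (_ ,_) (trans (cong (λ m → partner m _) flipped) (partner-flip (before _) _))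

      opposite-end : ∀ {i} → Black (e , i) → SameCircle after (e , opp i) (e , i)
      opposite-end b with black-ends bp b
      ... | inj₁ refl = Eq.symmetric _ merged
      ... | inj₂ refl = subst (λ i → SameCircle after (e , i) q) (sym (opp-involutive _)) merged

    transfer : ∀ {x y} → SameCircle before x y → SameCircle after x y
    transfer ε = ε
    transfer (fwd (b , refl) ◅ ss) = onward b ◅◅ transfer ss
    transfer (bwd (b , refl) ◅ ss) = Eq.symmetric _ (onward b) ◅◅ transfer ss

    onlyOld : ((_∈ₗ e ∷ X) ∖ e) ⊆ (_∈ₗ X)
    onlyOld (here eq , ≢e) = contradiction eq ≢e
    onlyOld (there i , _)  = i

    old : ∀ {x y} (b : Black x) (b′ : Black y) → Conn ((_∈ₗ e ∷ X) ∖ e) (vertex x b) (vertex y b′) →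
          SameCircle after x y
    old b b′ c = transfer (conn⇒sameCircle I b b′ (conn-mono onlyOld c))

    via : Conn ((_∈ₗ e ∷ X) ∖ e) (vertex x b) (vertex p bp) ×
          Conn ((_∈ₗ e ∷ X) ∖ e) (vertex q bq) (vertex y b′) → SameCircle after x y
    via (xp , qy) = old b bp xp ◅◅ merged ◅◅ old bq b′ qy

    via′ : Conn ((_∈ₗ e ∷ X) ∖ e) (vertex x b) (vertex q bq) ×
           Conn ((_∈ₗ e ∷ X) ∖ e) (vertex p bp) (vertex y b′) → SameCircle after x y
    via′ (xq , py) = old b bq xq ◅◅ Eq.symmetric _ merged ◅◅ old bp b′ py

  -- Any two black regions are joined by contracted edges, so all black ends lie on one circle; any
  -- other end is one arc away from a black one.
  basis⇒connected : ∀ {B : Vec Bool crossings} {s} → IsBasis (λ c → lookup B c ≡ true) →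
    (∀ c → lookup s c ≡ just (if lookup B c then contract c else delete c)) → ConnectedDiagram arc s
  basis⇒connected {B} {s} basis smoothed x y =
    let x′ , bx , xx′ = blackEnd x
        y′ , by , yy′ = blackEnd y
        c = conn-mono (∈-filter⁺ inB? (∈-allFin _)) (IsBasis.spanning basis _ _)
    in xx′ ◅◅ embed (conn⇒sameCircle (indep (filter⁺ inB? (allFin⁺ crossings)) in-T⇒in-B) bx by c)
           ◅◅ Eq.symmetric _ yy′
    where
    inB? : ∀ c → Dec (lookup B c ≡ true)
    inB? c = lookup B c Bool.≟ true

    T : List (Fin crossings)
    T = filter inB? (allFin crossings)

    in-T⇒in-B : ∀ {c} → c ∈ₗ T → lookup B c ≡ true
    in-T⇒in-B i = proj₂ (∈-filter⁻ inB? {xs = allFin crossings} i)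

    indep : ∀ {X} → Unique X → (∀ {c} → c ∈ₗ X → lookup B c ≡ true) → Independent X
    indep []       _   = []
    indep (e∉ ∷ u) inB =
      (λ j c → IsBasis.independent basis (inB (here refl)) j
        (conn-mono (λ i → inB (there i) , λ { refl → All.lookup e∉ i refl }) c)) ∷
      indep u (inB ∘ there)

    agrees : ∀ c → lookup s c ≡ just (contractAll T c)
    agrees c with lookup B c in eq | smoothed c
    ... | true  | p = trans p (cong just (sym (contractAll-∈ (∈-filter⁺ inB? (∈-allFin c) eq))))
    ... | false | p = trans p (cong just (sym (contractAll-∉ {X = T} λ i → case trans (sym eq) (in-T⇒in-B i) of λ ())))

    blackEnd : ∀ x → ∃[ x′ ] Black x′ × EqClosure (Adjacent arc s) x x′
    blackEnd x with black? x
    ... | inj₁ b = x , b , ε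
    ... | inj₂ w = arc x , ¬black-arc (λ b → case trans (sym w) b of λ ()) , fwd (along x) ◅ ε

    follow : ∀ x → EqClosure (Adjacent arc s) x (φ (contractAll T) x)
    follow x with partner-joint (contractAll T (proj₁ (arc x))) (proj₂ (arc x))
    ... | inj₁ k = fwd (along x) ◅ fwd (at _ (subst (λ m → Joint m _ _) (sym (agrees _)) k)) ◅ ε
    ... | inj₂ k = fwd (along x) ◅ bwd (at _ (subst (λ m → Joint m _ _) (sym (agrees _)) k)) ◅ ε

    embed : ∀ {x y} → SameCircle (contractAll T) x y → EqClosure (Adjacent arc s) x y
    embed ε = ε
    embed (fwd (_ , refl) ◅ ss) = follow _ ◅◅ embed ss
    embed (bwd (_ , refl) ◅ ss) = Eq.symmetric _ (follow _) ◅◅ embed ss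

-- Counting the remaining precrossings.

remaining : Position n → ℕ
remaining []            = 0
remaining (just _  ∷ s) = remaining s
remaining (nothing ∷ s) = suc (remaining s)

remaining-start : ∀ n → remaining (start {n}) ≡ n
remaining-start zero    = refl
remaining-start (suc n) = cong suc (remaining-start n)

remaining-move : ∀ (s : Position n) c m → lookup s c ≡ nothing → remaining s ≡ suc (remaining (s [ c ]≔ just m))
remaining-move (nothing ∷ s) zero    m refl = refl
remaining-move (just _  ∷ s) (suc c) m eq   = remaining-move s c m eq
remaining-move (nothing ∷ s) (suc c) m eq   = cong suc (remaining-move s c m eq)

remaining-after : ∀ (s : Position n) c m {k} → lookup s c ≡ nothing → remaining s ≡ suc k →
                  remaining (s [ c ]≔ just m) ≡ k
remaining-after s c m rem eq = ℕ.suc-injective (trans (sym (remaining-move s c m rem)) eq)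

somethingRemains : ∀ (s : Position n) {k} → remaining s ≡ suc k → ∃[ c ] lookup s c ≡ nothing
somethingRemains (nothing ∷ s) eq = zero , refl
somethingRemains (just _  ∷ s) eq = let c , p = somethingRemains s eq in suc c , p

nothingRemains : ∀ (s : Position n) → remaining s ≡ 0 → ∀ c → lookup s c ≢ nothing
nothingRemains (just _ ∷ s) eq (suc c) = nothingRemains s eq c

[]≔-unchanged : ∀ {A : Set} (xs : Vec A n) c {x} → lookup xs c ≡ x → xs [ c ]≔ x ≡ xs
[]≔-unchanged xs c refl = []≔-lookup xs c

-- The strategies of both players.

module Game (D : Shadow) (χ : Checkerboard D) where
  open Shadow D
  open Checkerboard χ
  open Circles D χ
  open Trees (blackGraph D χ)

  private variable
    s : Position crossings
    A B : Subset crossings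
    c e f : Fin crossings

  -- The position of which A and B are the two trees: an edge in both has been
  -- contracted and an edge in neither has been deleted.
  status : Fin crossings → Bool → Bool → Maybe Smoothing
  status c true  true  = just (contract c)
  status c false false = just (delete c)
  status c true  false = nothing
  status c false true  = nothing

  status-comm : ∀ c a b → status c a b ≡ status c b a
  status-comm c true  true  = refl
  status-comm c true  false = refl
  status-comm c false true  = refl
  status-comm c false false = refl

  Tree : Subset crossings → Set
  Tree A = IsBasis (λ c → lookup A c ≡ true)

  record Covers (s : Position crossings) (A B : Subset crossings) : Set where
    constructor covers
    field
      at-edge : ∀ c → lookup s c ≡ status c (lookup A c) (lookup B c)

  open Covers

  -- The invariant restored by each reply of `K`. Both trees live in the original graph and share
  -- the contracted edges, which stands in for passing to the contracted graph.
  record Paired (s : Position crossings) (A B : Subset crossings) : Set where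
    constructor paired
    field
      tree₁ : Tree A
      tree₂ : Tree B
      cover : Covers s A B

  open Paired

  swapTrees : Paired s A B → Paired s B A
  swapTrees {A = A} {B} (paired tA tB (covers cov)) =
    paired tB tA (covers λ c → trans (cov c) (status-comm c (lookup A c) (lookup B c)))

  covers-update : Covers s A B → ∀ c a b → Covers (s [ c ]≔ status c a b) (A [ c ]≔ a) (B [ c ]≔ b)
  covers-update {s} {A} {B} (covers cov) c a b = covers updated
    where
    updated : ∀ x → lookup (s [ c ]≔ status c a b) x ≡ status x (lookup (A [ c ]≔ a) x) (lookup (B [ c ]≔ b) x)
    updated x with x Fin.≟ c
    ... | yes refl = trans (lookup∘update c s _)
      (sym (cong₂ (status c) (lookup∘update c A a) (lookup∘update c B b)))
    ... | no x≢c = trans (lookup∘update′ x≢c s _)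
      (trans (cov x) (sym (cong₂ (status x) (lookup∘update′ x≢c A a) (lookup∘update′ x≢c B b))))

  exchanged : f ≢ e → IsBasis ((λ c → lookup A c ≡ true) [ e ↦ f ]) → Tree ((A [ e ]≔ false) [ f ]≔ true)
  exchanged {f} {e} {A} f≢e = basis-resp to from
    where
    A′ : Subset crossings
    A′ = (A [ e ]≔ false) [ f ]≔ true

    kept : c ≢ e → c ≢ f → lookup A′ c ≡ lookup A c
    kept c≢e c≢f = trans (lookup∘update′ c≢f (A [ e ]≔ false) true) (lookup∘update′ c≢e A false)

    to : ((λ c → lookup A c ≡ true) [ e ↦ f ]) c → lookup A′ c ≡ true
    to {c} c∈ with c Fin.≟ f | c∈
    ... | yes refl | _                  = lookup∘update c (A [ e ]≔ false) true
    ... | no c≢f   | inj₁ (c∈A , c≢e) = trans (kept c≢e c≢f) c∈A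
    ... | no c≢f   | inj₂ c≡f           = contradiction c≡f c≢f

    from : lookup A′ c ≡ true → ((λ c → lookup A c ≡ true) [ e ↦ f ]) c
    from {c} c∈ with c Fin.≟ f | c Fin.≟ e
    ... | yes c≡f | _         = inj₂ c≡f
    ... | no c≢f  | no c≢e   = inj₁ (trans (sym (kept c≢e c≢f)) c∈ , c≢e)
    ... | no c≢f  | yes refl with trans (sym c∈)
      (trans (lookup∘update′ c≢f (A [ c ]≔ false) true) (lookup∘update c A false))
    ... | ()

  _≟ᵥ_ : DecidableEquality (BlackRegion D χ)
  (r , _) ≟ᵥ (r′ , _) with r Fin.≟ r′
  ... | yes p = yes (blackRegion-≡ p)
  ... | no ¬p = no (¬p ∘ cong proj₁)

  Reply : Position crossings → Set
  Reply s = ∃[ f ] ∃[ m ] ∃[ A ] ∃[ B ] lookup s f ≡ nothing × Paired (s [ f ]≔ just m) A B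

  -- If e, in the first tree only, is deleted, it has to be replaced there by
  -- an edge f of the second tree, which is contracted; if e is contracted, it
  -- joins the second tree, from which f is deleted.
  reply₁ : Paired s A B → lookup A e ≡ true → lookup B e ≡ false → ∀ m → Reply (s [ e ]≔ just m)
  reply₁ {s} {A} {B} {e} (paired tA tB cov) e∈A e∉B m
    with symmetricExchange _≟ᵥ_ tA tB e∈A (λ e∈B → case trans (sym e∈B) e∉B of λ ())
  ... | f , f∈B , f∉A , tA′ , tB′ = respond (contract-or-delete e m)
    where
    Af : lookup A f ≡ false
    Af = ¬-not f∉A

    f≢e : f ≢ e
    f≢e refl = f∉A e∈A

    f-remains : lookup (s [ e ]≔ just m) f ≡ nothing
    f-remains = trans (lookup∘update′ f≢e s _) (trans (at-edge cov f) (cong₂ (status f) Af f∈B))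

    respond : m ≡ contract e ⊎ m ≡ delete e → Reply (s [ e ]≔ just m)
    respond (inj₁ refl) = f , delete f , A , (B [ e ]≔ true) [ f ]≔ false , f-remains , paired tA
      -- The exchange removes `f` before adding `e`, while the cover is updated at `e` first.
      (subst Tree ([]≔-commutes B f e f≢e) (exchanged {A = B} (f≢e ∘ sym) tB′))
      (subst (λ A′ → Covers _ A′ _)
        (trans (cong (_[ f ]≔ false) ([]≔-unchanged A e e∈A)) ([]≔-unchanged A f Af))
        (covers-update (covers-update cov e true true) f false false))
    respond (inj₂ refl) = f , contract f , (A [ e ]≔ false) [ f ]≔ true , B , f-remains , paired
      (exchanged {A = A} f≢e tA′)
      tB
      (subst (Covers _ _)
        (trans (cong (_[ f ]≔ true) ([]≔-unchanged B e e∉B)) ([]≔-unchanged B f f∈B))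
        (covers-update (covers-update cov e false false) f true true))

  reply : Paired s A B → lookup s c ≡ nothing → ∀ m → Reply (s [ c ]≔ just m)
  reply {s} {A} {B} {c} P rem m with lookup A c in a | lookup B c in b | trans (sym rem) (at-edge (cover P) c)
  ... | true  | false | _ = reply₁ P a b m
  ... | false | true  | _ = reply₁ (swapTrees P) b a m
  ... | true  | true  | ()
  ... | false | false | ()

  -- With nothing remaining the two trees coincide, so the contracted edges are exactly those of
  -- `A`.
  finished⇒connected : Paired s A B → (∀ c → lookup s c ≢ nothing) → ConnectedDiagram arc s
  finished⇒connected {s} {A} {B} P finished = basis⇒connected {A} (tree₁ P) smoothed
    where
    smoothed : ∀ c → lookup s c ≡ just (if lookup A c then contract c else delete c)
    smoothed c with lookup A c | lookup B c | at-edge (cover P) c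
    ... | true  | true  | p = p
    ... | false | false | p = p
    ... | true  | false | p = contradiction p (finished c)
    ... | false | true  | p = contradiction p (finished c)

  -- Whatever is played on the last edge, a reply would still find a remaining one.
  one-not-paired : Paired s A B → remaining s ≢ 1
  one-not-paired {s = s} P one with somethingRemains s one
  ... | c , rem with reply P rem horizontal
  ... | f , _ , _ , _ , rem′ , _ =
    nothingRemains (s [ c ]≔ just horizontal) (remaining-after s c horizontal rem one) f rem′

  K-wins : ∀ k → Paired s A B → remaining s ≡ k → CanWin D K L s
  K-wins {s} zero P eq = over (nothingRemains s eq) (finished⇒connected P (nothingRemains s eq))
  K-wins (suc zero) P eq = contradiction eq (one-not-paired P)
  K-wins {s} (suc (suc k)) P eq = answer (somethingRemains s eq) λ c m rem →
    let f , m′ , _ , _ , rem′ , P′ = reply P rem m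
    in move f m′ rem′ (K-wins k P′ (remaining-after (s [ c ]≔ just m) f m′ rem′ (remaining-after s c m rem eq)))

  -- An imagined play with replies of `K` removes edges two at a time; the choice of `horizontal` is
  -- arbitrary.
  remaining-even : ∀ k → Paired s A B → remaining s ≡ k → ∃[ h ] k ≡ h * 2
  remaining-even zero P eq = 0 , refl
  remaining-even (suc zero) P eq = contradiction eq (one-not-paired P)
  remaining-even {s} (suc (suc k)) P eq =
    let c , rem = somethingRemains s eq
        f , m′ , _ , _ , rem′ , P′ = reply P rem horizontal
        h , k≡ = remaining-even k P′ (remaining-after (s [ c ]≔ just horizontal) f m′ rem′
               (remaining-after s c horizontal rem eq))
    in suc h , cong (2 +_) k≡

  lastMove : lookup s c ≡ nothing → remaining s ≡ 1 → ∃[ m ] ¬ ConnectedDiagram arc (s [ c ]≔ just m)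
  -- The default `horizontal` is read only at `c`, since no other precrossing remains.
  lastMove {s} {c} rem one with disconnectingSmoothing c (λ d → fromMaybe horizontal (lookup s d))
  ... | m , disconnects = m , disconnects {s [ c ]≔ just m} {τ} smoothed
    (cong (fromMaybe horizontal) (lookup∘update c s (just m)))
    (λ d d≢c → cong (fromMaybe horizontal) (lookup∘update′ d≢c s (just m)))
    where
    τ : Fin crossings → Smoothing
    τ d = fromMaybe horizontal (lookup (s [ c ]≔ just m) d)

    smoothed : Smoothed (s [ c ]≔ just m) τ
    smoothed d with lookup (s [ c ]≔ just m) d in eq
    ... | just _  = refl
    ... | nothing = contradiction eq
      (nothingRemains (s [ c ]≔ just m) (remaining-after s c m rem one) d)

  -- By parity `L` makes the last move, and only that one matters; the earlier ones are arbitrary.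
  L-wins : ∀ h → remaining s ≡ suc h * 2 → CanWin D L K s
  L-wins {s} h eq = answer (somethingRemains s eq) λ c m rem →
    second h (remaining-after s c m rem eq)
    where
    second : ∀ {s} h → remaining s ≡ suc (h * 2) → CanWin D L L s
    second {s} zero eq =
      let c , rem = somethingRemains s eq
          m , disconnected = lastMove {s} rem eq
      in move c m rem (over (nothingRemains (s [ c ]≔ just m) (remaining-after s c m rem eq)) disconnected)
    second {s} (suc h) eq =
      let c , rem = somethingRemains s eq
      in move c horizontal rem (L-wins h (remaining-after s c horizontal rem eq))

  -- By Euler's formula there would be two regions, but a region needs a corner and hence a
  -- crossing. This guarantees `L` a last move.
  crossings≢0 : crossings ≢ 0
  crossings≢0 none = subst (λ n → ¬ Fin n) (sym none) (λ ()) (proj₁ (proj₁ (region-surjective (someRegion two-regions))))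
    where
    two-regions : regions ≡ 2
    two-regions = subst (λ n → n + regions ≡ 2 * n + 2) none euler

    someRegion : ∀ {r} → r ≡ 2 → Fin r
    someRegion refl = 0F

theorem8 : (D : Shadow) (χ : Checkerboard D) →
    let G = blackGraph D χ in
    Multigraph.IsConnected G →
    (T₁ T₂ : Subset (Multigraph.size G)) →
    Multigraph.IsSpanningTree G T₁ →
    Multigraph.IsSpanningTree G T₂ →
    Empty (T₁ ∩ T₂) →
    T₁ ∪ T₂ ≡ ⊤ →
    P-position D
theorem8 D χ _ T₁ T₂ tree₁ tree₂ disjoint covering = wins
  where
  open Shadow D
  open Game D χ
  open Trees (blackGraph D χ)

  -- Disjointness excludes an edge in both trees and covering an edge in neither, so every edge
  -- counts as remaining.
  covers-start : ∀ c → lookup start c ≡ status c (lookup T₁ c) (lookup T₂ c)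
  covers-start c rewrite lookup-replicate c (nothing {A = Smoothing})
    with lookup T₁ c in eq₁ | lookup T₂ c in eq₂
  ... | true  | false = refl
  ... | false | true  = refl
  ... | true  | true  = contradiction (c , x∈p∩q⁺ (lookup⇒[]= c T₁ eq₁ , lookup⇒[]= c T₂ eq₂)) disjoint
  ... | false | false with x∈p∪q⁻ T₁ T₂ (subst (c Data.Fin.Subset.∈_) (sym covering) ∈⊤)
  ... | inj₁ i = case trans (sym eq₁) ([]=⇒lookup i) of λ ()
  ... | inj₂ i = case trans (sym eq₂) ([]=⇒lookup i) of λ ()

  P : Paired start T₁ T₂
  P = paired (spanningTree⇒basis _≟ᵥ_ tree₁) (spanningTree⇒basis _≟ᵥ_ tree₂) (covers covers-start)

  wins : P-position D
  -- The argument of `wins` is the player who moves first.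
  wins L = K-wins crossings P (remaining-start crossings)
  wins K with remaining-even crossings P (remaining-start crossings)
  ... | zero  , none = contradiction none crossings≢0
  ... | suc h , even = L-wins h (trans (remaining-start crossings) even)
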